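{- Let $\mathsf{P}_1(\vec{u}_1)$ be an inductive heap predicate atom which is satisfiable, i.e. $\mathsf{P}_1(\vec{u}_1) \not\equiv \mathit{false}$. Then, under the least fixed point semantics of inductive heap predicates, there is no infinite chain $\dots \prec \mathsf{P}_n(\vec{u}_n) \prec \dots \prec \mathsf{P}_2(\vec{u}_2) \prec \mathsf{P}_1(\vec{u}_1)$ of the substructural relation $\prec$.
   Context: We work in symbolic-heap separation logic with inductive heap predicates: formulas are of the form $\exists\vec{w}.(\Sigma\wedge\Pi)$ where $\Sigma$ is a $*$-separated conjunction of spatial atoms ($\mathsf{emp}$, singleton heaps $x\mapsto_\iota(x_1,\dots,x_n)$, inductive predicate atoms $\mathsf{P}(x_1,\dots,x_n)$) and $\Pi$ is a pure (first-order, linear arithmetic and pointer equality) formula. Inductive predicates are defined by a system $\mathsf{P}_i(\vec{x}_i)\triangleq F^i_1(\vec{x}_i)\vee\dots\vee F^i_{m_i}(\vec{x}_i)$; each $F^i_j$ is a definition case of $\mathsf{P}_i$, written $F^i_j(\vec{x}_i)\Rightarrow \mathsf{P}_i(\vec{x}_i)$ (definition cases are instantiated to actual arguments in the obvious way). Predicates are interpreted by the least fixed point of the monotone operator induced by their definitions, with models being (stack, heap) pairs in the standard separation logic semantics; $\mathsf{P}(\vec u)\equiv\mathit{false}$ means no model satisfies it. Syntactic equivalence $\cong$ of spatial formulas is the least relation with $\mathsf{emp}\cong\mathsf{emp}$, each atom equivalent to itself, and $\Sigma_1\cong\Sigma_1'\wedge\Sigma_2\cong\Sigma_2'$ implying $\Sigma_1*\Sigma_2\cong\Sigma_1'*\Sigma_2'$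 and $\Sigma_1*\Sigma_2\cong\Sigma_2'*\Sigma_1'$; it extends to formulas $\exists\vec w.(\Sigma\wedge\Pi)$ componentwise. Substructural relation: $\mathsf{P}_1(\vec{v}) \prec \mathsf{P}_2(\vec{u})$ holds iff either (1) there are $\vec{w},\Sigma,\Pi$ and a definition case $F(\vec{u})\Rightarrow\mathsf{P}_2(\vec{u})$ with $F(\vec{u}) \cong \exists\vec{w}.(\mathsf{P}_1(\vec{v})*\Sigma\wedge\Pi)$; or (2) there are $\vec{w},\Sigma,\Pi$, a predicate atom $\mathsf{P}'(\vec{t})$ with $\mathsf{P}'(\vec{t})\prec\mathsf{P}_2(\vec{u})$, and a definition case $F(\vec{t})\Rightarrow\mathsf{P}'(\vec{t})$ with $F(\vec{t})\cong\exists\vec{w}.(\mathsf{P}_1(\vec{v})*\Sigma\wedge\Pi)$. That is, $\mathsf{P}_1(\vec v)$ occurs in a formula obtained by directly unfolding $\mathsf{P}_2(\vec u)$ or by unfolding some substructure of $\mathsf{P}_2(\vec u)$.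
   Formalization: Purely syntactic ≺-chains can be infinite for satisfiable atoms (e.g. list segments), so the theorem only excludes chains whose every atom has a model with a least-fixed-point derivation and whose every step is an unfolding made by the larger atom's derivation; satisfiability is then implied. -}

module Defs where

open import Data.Nat using (ℕ; suc)
open import Data.Integer as ℤ using (ℤ)
open import Data.Fin using (Fin)
open import Data.List using (List; []; _∷_; [_]; _++_; map)
open import Data.List.Relation.Unary.All as All using (All)
open import Data.List.Relation.Unary.All.Properties using (++⁺)
open import Data.List.Relation.Unary.Any using (here; there)
open import Data.List.Membership.Propositional.Properties using (∈-++⁺ˡ; ∈-++⁺ʳ; ∈-++⁻)
open import Data.List.Membership.Propositional using (_∈_)
open import Data.List.Relation.Binary.Subset.Propositional using (_⊆_)
open import Data.List.Relation.Binary.Subset.Propositional.Properties using (∷⁺ʳ; ++⁺ʳ)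
open import Data.Maybe using (Maybe; just; nothing)
open import Data.Product using (Σ; ∃; Σ-syntax; ∃-syntax; _×_; _,_; proj₁; proj₂)
open import Data.Sum as Sum using (_⊎_)
open import Data.Unit using (⊤)
open import Data.Empty using (⊥)
open import Relation.Nullary using (¬_)
open import Relation.Binary.PropositionalEquality using (_≡_; _≢_)

data Sort : Set where
  ptr int : Sort

Ctx : Set
Ctx = List Sort

Loc : Set
Loc = ℕ

-- `nothing` is the null pointer.
Val : Sort → Set
Val ptr = Maybe Loc
Val int = ℤ

Stack : Ctx → Set
Stack Γ = All Val Γ

-- Variables are well-sorted de Bruijn indices, so formulas are identified up
-- to renaming of bound variables and instantiation cannot capture.
data Term (Γ : Ctx) : Sort → Set where
  var    : ∀ {σ} → σ ∈ Γ → Term Γ σ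
  nil    : Term Γ ptr
  const  : ℤ → Term Γ int
  _⊕_    : Term Γ int → Term Γ int → Term Γ int
  _·_    : ℤ → Term Γ int → Term Γ int

data Pure (Γ : Ctx) : Set where
  true false    : Pure Γ
  _≐_           : ∀ {σ} → Term Γ σ → Term Γ σ → Pure Γ
  _≼_           : Term Γ int → Term Γ int → Pure Γ
  neg           : Pure Γ → Pure Γ
  _and_ _or_ _implies_ : Pure Γ → Pure Γ → Pure Γ
  all' ex'      : (σ : Sort) → Pure (σ ∷ Γ) → Pure Γ

renameTerm : ∀ {Γ Δ σ} → Γ ⊆ Δ → Term Γ σ → Term Δ σ
renameTerm ρ (var x)   = var (ρ x)
renameTerm ρ nil       = nil
renameTerm ρ (const k) = const k
renameTerm ρ (t ⊕ u)   = renameTerm ρ t ⊕ renameTerm ρ u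
renameTerm ρ (k · t)   = k · renameTerm ρ t

renamePure : ∀ {Γ Δ} → Γ ⊆ Δ → Pure Γ → Pure Δ
renamePure ρ true          = true
renamePure ρ false         = false
renamePure ρ (t ≐ u)       = renameTerm ρ t ≐ renameTerm ρ u
renamePure ρ (t ≼ u)       = renameTerm ρ t ≼ renameTerm ρ u
renamePure ρ (neg p)       = neg (renamePure ρ p)
renamePure ρ (p and q)     = renamePure ρ p and renamePure ρ q
renamePure ρ (p or q)      = renamePure ρ p or renamePure ρ q
renamePure ρ (p implies q) = renamePure ρ p implies renamePure ρ q
renamePure ρ (all' σ p)    = all' σ (renamePure (∷⁺ʳ σ ρ) p)
renamePure ρ (ex' σ p)     = ex' σ (renamePure (∷⁺ʳ σ ρ) p)

evalTerm : ∀ {Γ σ} → Stack Γ → Term Γ σ → Val σ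
evalTerm s (var x)   = All.lookup s x
evalTerm s nil       = nothing
evalTerm s (const k) = k
evalTerm s (t ⊕ u)   = evalTerm s t ℤ.+ evalTerm s u
evalTerm s (k · t)   = k ℤ.* evalTerm s t

_⊨ᵖ_ : ∀ {Γ} → Stack Γ → Pure Γ → Set
s ⊨ᵖ true          = ⊤
s ⊨ᵖ false         = ⊥
s ⊨ᵖ (t ≐ u)       = evalTerm s t ≡ evalTerm s u
s ⊨ᵖ (t ≼ u)       = evalTerm s t ℤ.≤ evalTerm s u
s ⊨ᵖ neg p         = ¬ (s ⊨ᵖ p)
s ⊨ᵖ (p and q)     = (s ⊨ᵖ p) × (s ⊨ᵖ q)
s ⊨ᵖ (p or q)      = (s ⊨ᵖ p) ⊎ (s ⊨ᵖ q)
s ⊨ᵖ (p implies q) = s ⊨ᵖ p → s ⊨ᵖ q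
s ⊨ᵖ all' σ p      = (v : Val σ) → (v All.∷ s) ⊨ᵖ p
s ⊨ᵖ ex' σ p       = Σ[ v ∈ Val σ ] (v All.∷ s) ⊨ᵖ p

record Signature : Set₁ where
  field
    Node    : Set                   -- the sorts ι of singleton heaps
    fields  : Node → List Sort
    #preds  : ℕ
    params  : Fin #preds → Ctx

module Syntax (Sg : Signature) where
  open Signature Sg

  record Atom (Γ : Ctx) : Set where
    constructor _$_
    field
      pred : Fin #preds
      args : All (_∈ Γ) (params pred)

  data SpatialAtom (Γ : Ctx) : Set where
    _↦⟨_⟩_ : ptr ∈ Γ → (ι : Node) → All (_∈ Γ) (fields ι) → SpatialAtom Γ
    atom   : Atom Γ → SpatialAtom Γ

  -- ∗-separated conjunctions are kept flat, with emp the empty conjunction: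
  -- ∗ is associative and emp is its unit by construction.
  Spatial : Ctx → Set
  Spatial Γ = List (SpatialAtom Γ)

  emp : ∀ {Γ} → Spatial Γ
  emp = []

  infixr 6 _∗_
  _∗_ : ∀ {Γ} → Spatial Γ → Spatial Γ → Spatial Γ
  _∗_ = _++_

  record Formula (Γ : Ctx) : Set where
    constructor ∃⟨_⟩_∧_
    field
      bound   : Ctx
      spatial : Spatial (bound ++ Γ)
      pure    : Pure (bound ++ Γ)

  renameSpatialAtom : ∀ {Γ Δ} → Γ ⊆ Δ → SpatialAtom Γ → SpatialAtom Δ
  renameSpatialAtom ρ (x ↦⟨ ι ⟩ ys)   = ρ x ↦⟨ ι ⟩ All.map ρ ys
  renameSpatialAtom ρ (atom (P $ us)) = atom (P $ All.map ρ us)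

  renameSpatial : ∀ {Γ Δ} → Γ ⊆ Δ → Spatial Γ → Spatial Δ
  renameSpatial ρ = map (renameSpatialAtom ρ)

  renameFormula : ∀ {Γ Δ} → Γ ⊆ Δ → Formula Γ → Formula Δ
  renameFormula ρ (∃⟨ W ⟩ Sp ∧ Pu) =
    ∃⟨ W ⟩ renameSpatial (++⁺ʳ W ρ) Sp ∧ renamePure (++⁺ʳ W ρ) Pu

  infix 4 _≅_ _≅ᶠ_
  data _≅_ {Γ : Ctx} : Spatial Γ → Spatial Γ → Set where
    ≅-emp   : emp ≅ emp
    ≅-atom  : ∀ {a} → [ a ] ≅ [ a ]
    ∗-cong  : ∀ {Σ₁ Σ₁′ Σ₂ Σ₂′} → Σ₁ ≅ Σ₁′ → Σ₂ ≅ Σ₂′ → Σ₁ ∗ Σ₂ ≅ Σ₁′ ∗ Σ₂′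
    ∗-swap  : ∀ {Σ₁ Σ₁′ Σ₂ Σ₂′} → Σ₁ ≅ Σ₁′ → Σ₂ ≅ Σ₂′ → Σ₁ ∗ Σ₂ ≅ Σ₂′ ∗ Σ₁′

  data _≅ᶠ_ {Γ : Ctx} : Formula Γ → Formula Γ → Set where
    ex-cong : ∀ {W} {Sp Sp′ : Spatial (W ++ Γ)} {Pu : Pure (W ++ Γ)} →
              Sp ≅ Sp′ → ∃⟨ W ⟩ Sp ∧ Pu ≅ᶠ ∃⟨ W ⟩ Sp′ ∧ Pu

  Cell : Set
  Cell = Σ[ ι ∈ Node ] All Val (fields ι)

  record Heap : Set where
    field
      at     : Loc → Maybe Cell
      finite : ∃[ ls ] ∀ l → at l ≢ nothing → l ∈ ls
  open Heap public

  EmptyHeap : Heap → Set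
  EmptyHeap h = ∀ l → at h l ≡ nothing

  IsSingleton : Heap → Loc → Cell → Set
  IsSingleton h l c = at h l ≡ just c × (∀ l′ → l′ ≢ l → at h l′ ≡ nothing)

  -- h is the union of the disjoint heaps h₁ and h₂.
  Splits : Heap → Heap → Heap → Set
  Splits h h₁ h₂ = ∀ l → (at h l ≡ at h₁ l × at h₂ l ≡ nothing)
                       ⊎ (at h l ≡ at h₂ l × at h₁ l ≡ nothing)

  Interp : Set₁
  Interp = ∀ {Γ} → Atom Γ → Stack Γ → Heap → Set

  Satᵃ : Interp → ∀ {Γ} → SpatialAtom Γ → Stack Γ → Heap → Set
  Satᵃ X (x ↦⟨ ι ⟩ ys) s h =
    Σ[ l ∈ Loc ] All.lookup s x ≡ just l × IsSingleton h l (ι , All.map (All.lookup s) ys)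
  Satᵃ X (atom A)      s h = X A s h

  Satˢ : Interp → ∀ {Γ} → Spatial Γ → Stack Γ → Heap → Set
  Satˢ X []       s h = EmptyHeap h
  Satˢ X (a ∷ Sp) s h =
    Σ[ h₁ ∈ Heap ] Σ[ h₂ ∈ Heap ] Splits h h₁ h₂ × Satᵃ X a s h₁ × Satˢ X Sp s h₂

  Satᶠ : Interp → ∀ {Γ} → Formula Γ → Stack Γ → Heap → Set
  Satᶠ X (∃⟨ W ⟩ Sp ∧ Pu) s h =
    Σ[ ws ∈ Stack W ] Satˢ X Sp (++⁺ ws s) h × (++⁺ ws s ⊨ᵖ Pu)

  ∈-resp-≅ : ∀ {Γ} {Σ₁ Σ₂ : Spatial Γ} {a} → Σ₁ ≅ Σ₂ → a ∈ Σ₂ → a ∈ Σ₁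
  ∈-resp-≅ ≅-atom i = i
  ∈-resp-≅ (∗-cong {Σ₁} {Σ₁′} p q) i with ∈-++⁻ Σ₁′ i
  ... | Sum.inj₁ j = ∈-++⁺ˡ (∈-resp-≅ p j)
  ... | Sum.inj₂ j = ∈-++⁺ʳ Σ₁ (∈-resp-≅ q j)
  ∈-resp-≅ (∗-swap {Σ₁} {Σ₂′ = Σ₂′} p q) i with ∈-++⁻ Σ₂′ i
  ... | Sum.inj₁ j = ∈-++⁺ʳ Σ₁ (∈-resp-≅ q j)
  ... | Sum.inj₂ j = ∈-++⁺ˡ (∈-resp-≅ p j)

  -- The part of the heap assigned to an occurrence of a, and its justification.
  conjunct : ∀ {X : Interp} {Γ} {a : SpatialAtom Γ} (Sp : Spatial Γ) {s h} →
             Satˢ X Sp s h → a ∈ Sp → Σ[ h′ ∈ Heap ] Satᵃ X a s h′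
  conjunct (a ∷ Sp) (h₁ , h₂ , sp , d , ds) (here _≡_.refl) = h₁ , d
  conjunct {X} (a ∷ Sp) (h₁ , h₂ , sp , d , ds) (there i)   = conjunct {X} Sp ds i

record System (Sg : Signature) : Set where
  open Signature Sg
  open Syntax Sg
  field
    #cases : Fin #preds → ℕ
    body   : (P : Fin #preds) → Fin (#cases P) → Formula (params P)

module SeparationLogic (Sg : Signature) (D : System Sg) where
  open Signature Sg public
  open Syntax Sg public
  open System D public

  Case : ∀ {Γ} → Atom Γ → Set
  Case A = Fin (#cases (Atom.pred A))

  unfold : ∀ {Γ} (A : Atom Γ) → Case A → Formula Γ
  unfold (P $ us) c = renameFormula (All.lookup us) (body P c)

  -- The monotone operator induced by the definitions.
  Φ : Interp → Interp
  Φ X A s h = Σ[ c ∈ Case A ] Satᶠ X (unfold A c) s h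

  -- Its least fixed point.  An inhabitant is a lfp derivation that (s , h) is
  -- a model of A; `LFP-least` is the universal property.
  data LFP {Γ} (A : Atom Γ) (s : Stack Γ) (h : Heap) : Set where
    fold : Φ LFP A s h → LFP A s h

  LFP-least : (X : Interp) →
              (∀ {Γ} (A : Atom Γ) s h → Φ X A s h → X A s h) →
              ∀ {Γ} (A : Atom Γ) s h → LFP A s h → X A s h
  LFP-least X closed = go
    where
    go  : ∀ {Γ} (A : Atom Γ) s h → LFP A s h → X A s h
    goˢ : ∀ {Γ} (Sp : Spatial Γ) s h → Satˢ LFP Sp s h → Satˢ X Sp s h
    go A s h (fold (c , ws , d , π)) =
      closed A s h (c , ws , goˢ (Formula.spatial (unfold A c)) (++⁺ ws s) h d , π)
    goˢ []                   s h d = d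
    goˢ ((x ↦⟨ ι ⟩ ys) ∷ Sp) s h (h₁ , h₂ , sp , d , ds) =
      h₁ , h₂ , sp , d , goˢ Sp s h₂ ds
    goˢ (atom A ∷ Sp)        s h (h₁ , h₂ , sp , d , ds) =
      h₁ , h₂ , sp , go A s h₁ d , goˢ Sp s h₂ ds

  _≡false : ∀ {Γ} → Atom Γ → Set
  A ≡false = ∀ s h → ¬ LFP A s h

  infix 4 _⋖_ _≺_

  -- B ⋖ A : for some definition case F(u⃗) of A, F(u⃗) ≅ ∃w⃗.(B ∗ Σ ∧ Π).
  -- B lives in the context of A extended by w⃗.
  data _⋖_ {Γ} : ∀ {Δ} → Atom Δ → Atom Γ → Set where
    occurs : ∀ {A : Atom Γ} {W} {B : Atom (W ++ Γ)} {Sp : Spatial (W ++ Γ)} {Pu : Pure (W ++ Γ)}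
             (c : Case A) → unfold A c ≅ᶠ ∃⟨ W ⟩ [ atom B ] ∗ Sp ∧ Pu → B ⋖ A

  data _≺_ {Γ} : ∀ {Δ} → Atom Δ → Atom Γ → Set where
    direct : ∀ {Δ} {B : Atom Δ} {A : Atom Γ} → B ⋖ A → B ≺ A
    nested : ∀ {Δ Θ} {B : Atom Δ} {T : Atom Θ} {A : Atom Γ} → T ≺ A → B ⋖ T → B ≺ A

  record InfiniteChain {Γ} (A : Atom Γ) : Set where
    field
      ctx    : ℕ → Ctx
      link   : (n : ℕ) → Atom (ctx n)
      starts : (ctx 0 , link 0) ≡ (Γ , A)
      step   : (n : ℕ) → link (suc n) ≺ link n

  -- Without reference to the semantics, satisfiable atoms do have infinite
  -- ≺-chains: for ls(x) ≜ (emp ∧ x=nil) ∨ ∃y.(x↦y ∗ ls(y)) one has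
  -- … ≺ ls(z) ≺ ls(y) ≺ ls(x).  A chain arises under the least fixed point
  -- semantics when each of its links is interpreted by a stack, a heap and a
  -- derivation, and each step B ≺ A is an unfolding made by the derivation of A.
  -- Models alone would not do: for P ≜ emp ∨ P, every link of
  -- … ≺ P ≺ P ≺ P is satisfied by the empty heap, and so is each unfolding.
  Model : ∀ {Γ} → Atom Γ → Set
  Model {Γ} A = Σ[ s ∈ Stack Γ ] Σ[ h ∈ Heap ] LFP A s h

  occurrence : ∀ {Γ W} {F : Formula Γ} {B : Atom (W ++ Γ)} {Sp : Spatial (W ++ Γ)} {Pu : Pure (W ++ Γ)} {s h} →
               F ≅ᶠ ∃⟨ W ⟩ [ atom B ] ∗ Sp ∧ Pu → Satᶠ LFP F s h → Model B
  occurrence {F = F} {s = s} (ex-cong p) (ws , d , π) =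
    ++⁺ ws s , conjunct {LFP} (Formula.spatial F) d (∈-resp-≅ p (here _≡_.refl))

  data Unfolds {Γ} : ∀ {Δ} {B : Atom Δ} {A : Atom Γ} → B ⋖ A → Model A → Model B → Set where
    unfolds : ∀ {A : Atom Γ} {W} {B : Atom (W ++ Γ)} {Sp : Spatial (W ++ Γ)} {Pu : Pure (W ++ Γ)}
              {c : Case A} {e : unfold A c ≅ᶠ ∃⟨ W ⟩ [ atom B ] ∗ Sp ∧ Pu} {s h}
              (d : Satᶠ LFP (unfold A c) s h) →
              Unfolds (occurs {A = A} c e) (s , h , fold {A = A} (c , d)) (occurrence e d)

  Realises : ∀ {Γ Δ} {B : Atom Δ} {A : Atom Γ} → B ≺ A → Model A → Model B → Set
  Realises (direct o)           M N = Unfolds o M N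
  Realises (nested {T = T} p o) M N = Σ[ K ∈ Model T ] Realises p M K × Unfolds o K N

  record UnderLFP {Γ} {A : Atom Γ} (C : InfiniteChain A) : Set where
    open InfiniteChain C
    field
      model    : (n : ℕ) → Model (link n)
      realised : (n : ℕ) → Realises (step n) (model n) (model (suc n))

{-# OPTIONS --safe #-}
-- A derivation of a least fixed point is a well-founded tree, and each step
-- B ≺ A realised by a chain descends from the derivation of A to a proper
-- subtree deriving B.  Such descent cannot continue for ever.
module Submission where

open import Defs
open import Data.Product using (Σ-syntax)
open import Relation.Nullary using (¬_)
open import Data.List using ([]; _∷_; [_]; _++_)
open import Data.List.Membership.Propositional using (_∈_)
open import Data.List.Relation.Unary.Any using (here; there)
open import Data.Nat using (ℕ; suc)
open import Data.Product using (∃-syntax; _,_)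
open import Induction.InfiniteDescent
  using (InfiniteDescendingSequence; descent∧acc⇒unsatisfiable)
open import Induction.WellFounded using (Acc; acc; WellFounded)
open import Relation.Binary.Construct.Closure.Transitive as ⁺
  using (TransClosure; _∷_)
open import Relation.Binary.PropositionalEquality using (_≡_; refl)

wellFounded⇒noInfiniteDescent :
  ∀ {a r} {A : Set a} {_<_ : A → A → Set r} → WellFounded _<_ →
  (f : ℕ → A) → ¬ InfiniteDescendingSequence _<_ f
wellFounded⇒noInfiniteDescent {_<_ = _<_} wf f desc =
  -- `P` is the property of being a value of `f`; the next value of the sequence witnesses its
  -- descent.
  descent∧acc⇒unsatisfiable {_<_ = _<_} {P = λ x → ∃[ n ] f n ≡ x}
    (λ { (n , refl) → f (suc n) , desc n , suc n , refl })
    (wf (f 0)) (0 , refl)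

module _ {Sg : Signature} {D : System Sg} where
  open SeparationLogic Sg D

  -- Contexts vary along a chain, so they are packed in. The derivation inside `Model` is what
  -- shrinks; stack and heap may stay the same.
  ModelledAtom : Set
  ModelledAtom = Σ[ Γ ∈ Ctx ] Σ[ A ∈ Atom Γ ] Model A

  infix 4 _⊏_ _⊏⁺_

  data _⊏_ : ModelledAtom → ModelledAtom → Set where
    subderivation : ∀ {Γ Δ} {B : Atom Δ} {A : Atom Γ} {o : B ⋖ A} {M N} →
                    Unfolds o M N → (Δ , B , N) ⊏ (Γ , A , M)

  _⊏⁺_ : ModelledAtom → ModelledAtom → Set
  _⊏⁺_ = TransClosure _⊏_

  -- Stated for an arbitrary formula F, since unfold A c is not a constructor
  -- form against which ≅ᶠ could be matched.
  occurrence-acc :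
    ∀ {Γ W} {F : Formula Γ} {B : Atom (W ++ Γ)} {Sp Pu s h}
    (e : F ≅ᶠ ∃⟨ W ⟩ [ atom B ] ∗ Sp ∧ Pu) ((ws , d , π) : Satᶠ LFP F s h) →
    (∀ {B} (i : atom B ∈ Formula.spatial F) →
       Acc _⊏_ (_ , B , _ , conjunct {LFP} (Formula.spatial F) d i)) →
    Acc _⊏_ (_ , B , occurrence e (ws , d , π))
  occurrence-acc (ex-cong p) _ conjuncts = conjuncts (∈-resp-≅ p (here refl))

  mutual
    derivation-acc : ∀ {Γ} {A : Atom Γ} {s h} (d : LFP A s h) →
                     Acc _⊏_ (Γ , A , s , h , d)
    derivation-acc {A = A} (fold (c , ws , d , π)) =
      -- Matching on `unfolds` forces the predecessor to be an occurrence inside this very `fold`.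
      acc λ { (subderivation (unfolds {e = e} _)) →
                occurrence-acc e (ws , d , π)
                  (conjunct-acc (Formula.spatial (unfold A c)) d) }

    -- Retraces the recursion of `conjunct`, so that the derivation passed back to `derivation-acc`
    -- is visibly a subterm.
    conjunct-acc : ∀ {Γ} {B : Atom Γ} (Sp : Spatial Γ) {s h}
                   (d : Satˢ LFP Sp s h) (i : atom B ∈ Sp) →
                   Acc _⊏_ (Γ , B , s , conjunct {LFP} Sp d i)
    conjunct-acc (_ ∷ _)  (_ , _ , _ , d , _)  (here refl) = derivation-acc d
    conjunct-acc (_ ∷ Sp) (_ , _ , _ , _ , ds) (there i)   = conjunct-acc Sp ds i

  ⊏-wellFounded : WellFounded _⊏_
  ⊏-wellFounded (_ , _ , _ , _ , d) = derivation-acc d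

  -- One step of `≺` may pass through several unfoldings, hence the transitive closure. The
  -- unfolding added by `nested` is the deepest, so it heads the path.
  realises⇒⊏⁺ : ∀ {Γ Δ} {B : Atom Δ} {A : Atom Γ} (p : B ≺ A) {M N} →
                Realises p M N → (Δ , B , N) ⊏⁺ (Γ , A , M)
  realises⇒⊏⁺ (direct _)   u           = ⁺.[ subderivation u ]
  realises⇒⊏⁺ (nested p _) (_ , r , u) = subderivation u ∷ realises⇒⊏⁺ p r

theorem3p13 : (Sg : Signature) (D : System Sg) → let open SeparationLogic Sg D in
    ∀ {Γ} (P₁ : Atom Γ) → ¬ (P₁ ≡false) → ¬ (Σ[ C ∈ InfiniteChain P₁ ] UnderLFP C)
theorem3p13 Sg D P₁ _ (C , under) =
  wellFounded⇒noInfiniteDescent (⁺.wellFounded _ ⊏-wellFounded)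
    (λ n → ctx n , link n , model n)
    (λ n → realises⇒⊏⁺ (step n) (realised n))
  where
  open SeparationLogic Sg D
  open InfiniteChain C
  open UnderLFP under
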